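{- Let $\mathbb{Z}[i]$ be the Gaussian integers and $\mathcal{E}_{ -1} = \{ n \in \mathbb{Z}[i] : |n|^2 \le 2\}$. For every $n \in \mathbb{Z}[i] \setminus \mathcal{E}_{ -1}$ there exist nonzero $a,b,c \in \mathbb{Z}[i]$ with $\frac{4}{n} = \frac1a + \frac1b + \frac1c$.
   Context: For $n = x + yi$ with $x,y \in \mathbb{Z}$, $|n|^2 = x^2 + y^2$. -}

module Defs where

open import Data.Integer using (ℤ; +_; _+_; _-_; _*_; _≤_)
open import Data.Product using (_×_; _,_)
open import Relation.Binary.PropositionalEquality using (_≡_)
open import Relation.Nullary using (¬_)

record ℤ[i] : Set where
  constructor _+_i
  field
    re : ℤ
    im : ℤ
open ℤ[i] public

infixl 6 _+ᵍ_
infixl 7 _*ᵍ_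

_+ᵍ_ : ℤ[i] → ℤ[i] → ℤ[i]
(a + b i) +ᵍ (c + d i) = (a + c) + (b + d) i

_*ᵍ_ : ℤ[i] → ℤ[i] → ℤ[i]
(a + b i) *ᵍ (c + d i) = (a * c - b * d) + (a * d + b * c) i

0ᵍ : ℤ[i]
0ᵍ = (+ 0) + (+ 0) i

4ᵍ : ℤ[i]
4ᵍ = (+ 4) + (+ 0) i

normSq : ℤ[i] → ℤ
normSq (x + y i) = x * x + y * y

inE₋₁ : ℤ[i] → Set
inE₋₁ n = normSq n ≤ + 2

-- 4/n = 1/a + 1/b + 1/c for nonzero n,a,b,c in the domain ℤ[i],
-- written with denominators cleared (multiply by n a b c):
--   4 a b c = n (b c + a c + a b)
ErdosStrausEq : ℤ[i] → ℤ[i] → ℤ[i] → ℤ[i] → Set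
ErdosStrausEq n a b c =
  4ᵍ *ᵍ a *ᵍ b *ᵍ c ≡ n *ᵍ (b *ᵍ c +ᵍ a *ᵍ c +ᵍ a *ᵍ b)

{-# OPTIONS --safe #-}
module Submission where

-- If n = 4k + s with n and k nonzero, then 4/n - 1/k = -s/(nk), so it suffices to write
-- s/(nk) as a sum of two unit fractions. Modulo 4 one can take s to be a unit or of
-- norm 2 (then s divides 2, and s/(nk) is twice a unit fraction), or s = 2q + u with q, u
-- units, u = ±iq; the remaining n are multiples of 2, where 4/(2m) = 1/m + 1/(2m) + 1/(2m).
-- For s = 2q + u put p = q + u, of norm 2: if p divides k, then s = p + q is a sum of two
-- divisors of nk. Otherwise replace k by k + q and q by -q. The case k = 0, n = 2q + u
-- has a solution with a = q, b = p.

open import Defs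
open import Algebra.Bundles using (CommutativeRing)
open import Algebra.Consequences.Propositional using (comm∧idˡ⇒id; comm∧invˡ⇒inv)
open import Data.Fin using (Fin)
open import Data.Fin.Patterns using (0F; 1F; 2F; 3F)
open import Data.Integer as ℤ using (ℤ; +_; -[1+_]; -_; _+_; _*_; _-_; ∣_∣)
open import Data.Integer.DivMod using (_%ℕ_; _/ℕ_; n%ℕd<d; a≡a%ℕn+[a/ℕn]*n)
import Data.Integer.Properties as ℤ
open import Data.Integer.Tactic.RingSolver using (solve-∀)
open import Data.Nat as ℕ using (suc; s≤s)
import Data.Nat.Properties as ℕ
open import Data.Product using (Σ; ∃₂; _×_; _,_)
open import Data.Sum using (inj₁; inj₂)
open import Function using (_∘_)
open import Level using (0ℓ)
open import Relation.Binary.Definitions using (DecidableEquality)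
open import Relation.Binary.PropositionalEquality
  using (_≡_; _≢_; refl; sym; trans; cong; cong₂; subst; setoid; isEquivalence; module ≡-Reasoning)
open import Relation.Nullary using (¬_; yes; no)
open import Relation.Nullary.Decidable using (True; toWitness; map′; _×-dec_; dec⇒maybe)
open import Tactic.RingSolver using () renaming (solve-∀ to solve-∀-over)
open import Tactic.RingSolver.Core.AlmostCommutativeRing
  using (AlmostCommutativeRing; fromCommutativeRing)
open import Algebra.Consequences.Setoid (setoid ℤ[i]) using (comm∧distrˡ⇒distr)
open import Algebra.Structures {A = ℤ[i]} _≡_ using (IsCommutativeRing)
open ≡-Reasoning

-- Ring structure on the Gaussian integers.

1ᵍ : ℤ[i]
1ᵍ = (+ 1) + (+ 0) i

infix 8 -ᵍ_
-ᵍ_ : ℤ[i] → ℤ[i]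
-ᵍ (a + b i) = (- a) + (- b) i

_≟ᵍ_ : DecidableEquality ℤ[i]
(a + b i) ≟ᵍ (c + d i) =
  map′ (λ (p , q) → cong₂ _+_i p q) (λ p → cong re p , cong im p) (a ℤ.≟ c ×-dec b ℤ.≟ d)

*ᵍ-assoc : ∀ x y z → (x *ᵍ y) *ᵍ z ≡ x *ᵍ (y *ᵍ z)
*ᵍ-assoc (a + b i) (c + d i) (e + f i) = cong₂ _+_i (re≡ a b c d e f) (im≡ a b c d e f)
  where
  re≡ : ∀ a b c d e f → (a * c - b * d) * e - (a * d + b * c) * f ≡ a * (c * e - d * f) - b * (c * f + d * e)
  re≡ = solve-∀
  im≡ : ∀ a b c d e f → (a * c - b * d) * f + (a * d + b * c) * e ≡ a * (c * f + d * e) + b * (c * e - d * f)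
  im≡ = solve-∀

*ᵍ-comm : ∀ x y → x *ᵍ y ≡ y *ᵍ x
*ᵍ-comm (a + b i) (c + d i) = cong₂ _+_i (re≡ a b c d) (im≡ a b c d)
  where
  re≡ : ∀ a b c d → a * c - b * d ≡ c * a - d * b
  re≡ = solve-∀
  im≡ : ∀ a b c d → a * d + b * c ≡ c * b + d * a
  im≡ = solve-∀

*ᵍ-identityˡ : ∀ x → 1ᵍ *ᵍ x ≡ x
*ᵍ-identityˡ (a + b i) = cong₂ _+_i (re≡ a b) (im≡ a b)
  where
  re≡ : ∀ a b → + 1 * a - + 0 * b ≡ a
  re≡ = solve-∀
  im≡ : ∀ a b → + 1 * b + + 0 * a ≡ b
  im≡ = solve-∀

*ᵍ-distribˡ-+ᵍ : ∀ x y z → x *ᵍ (y +ᵍ z) ≡ x *ᵍ y +ᵍ x *ᵍ z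
*ᵍ-distribˡ-+ᵍ (a + b i) (c + d i) (e + f i) = cong₂ _+_i (re≡ a b c d e f) (im≡ a b c d e f)
  where
  re≡ : ∀ a b c d e f → a * (c + e) - b * (d + f) ≡ (a * c - b * d) + (a * e - b * f)
  re≡ = solve-∀
  im≡ : ∀ a b c d e f → a * (d + f) + b * (c + e) ≡ (a * d + b * c) + (a * f + b * e)
  im≡ = solve-∀

+ᵍ-comm : ∀ x y → x +ᵍ y ≡ y +ᵍ x
+ᵍ-comm (a + b i) (c + d i) = cong₂ _+_i (ℤ.+-comm a c) (ℤ.+-comm b d)

+ᵍ-*ᵍ-isCommutativeRing : IsCommutativeRing _+ᵍ_ _*ᵍ_ -ᵍ_ 0ᵍ 1ᵍ
+ᵍ-*ᵍ-isCommutativeRing = record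
  { isRing = record
    { +-isAbelianGroup = record
      { isGroup = record
        { isMonoid = record
          { isSemigroup = record
            { isMagma = record { isEquivalence = isEquivalence ; ∙-cong = cong₂ _+ᵍ_ }
            ; assoc = λ (a + b i) (c + d i) (e + f i) → cong₂ _+_i (ℤ.+-assoc a c e) (ℤ.+-assoc b d f)
            }
          ; identity = comm∧idˡ⇒id +ᵍ-comm λ (a + b i) → cong₂ _+_i (ℤ.+-identityˡ a) (ℤ.+-identityˡ b)
          }
        ; inverse = comm∧invˡ⇒inv +ᵍ-comm λ (a + b i) → cong₂ _+_i (ℤ.+-inverseˡ a) (ℤ.+-inverseˡ b)
        ; ⁻¹-cong = cong -ᵍ_
        }
      ; comm = +ᵍ-comm
      }
    ; *-cong = cong₂ _*ᵍ_
    ; *-assoc = *ᵍ-assoc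
    ; *-identity = comm∧idˡ⇒id *ᵍ-comm *ᵍ-identityˡ
    ; distrib = comm∧distrˡ⇒distr (cong₂ _+ᵍ_) *ᵍ-comm *ᵍ-distribˡ-+ᵍ
    }
  ; *-comm = *ᵍ-comm
  }

+ᵍ-*ᵍ-commutativeRing : CommutativeRing 0ℓ 0ℓ
+ᵍ-*ᵍ-commutativeRing = record { isCommutativeRing = +ᵍ-*ᵍ-isCommutativeRing }

-- Input for the ring solver, so that later identities need no splitting into coordinates.
gaussianRing : AlmostCommutativeRing 0ℓ 0ℓ
gaussianRing = fromCommutativeRing +ᵍ-*ᵍ-commutativeRing λ x → dec⇒maybe (0ᵍ ≟ᵍ x)

infixl 6 _-ᵍ_
_-ᵍ_ : ℤ[i] → ℤ[i] → ℤ[i]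
x -ᵍ y = x +ᵍ -ᵍ y

-- The norm and the absence of zero divisors.

normSq-*ᵍ : ∀ x y → normSq (x *ᵍ y) ≡ normSq x * normSq y
normSq-*ᵍ (a + b i) (c + d i) = eq a b c d
  where
  eq : ∀ a b c d → (a * c - b * d) * (a * c - b * d) + (a * d + b * c) * (a * d + b * c)
                 ≡ (a * a + b * b) * (c * c + d * d)
  eq = solve-∀

i*i≡+∣i∣*∣i∣ : ∀ a → a * a ≡ + (∣ a ∣ ℕ.* ∣ a ∣)
i*i≡+∣i∣*∣i∣ (+ n)    = ℤ.+◃n≡+n (n ℕ.* n)
i*i≡+∣i∣*∣i∣ -[1+ n ] = refl

∣i∣*∣i∣≡0⇒i≡0 : ∀ a → ∣ a ∣ ℕ.* ∣ a ∣ ≡ 0 → a ≡ + 0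
∣i∣*∣i∣≡0⇒i≡0 (+ 0) _ = refl

-- Both squares are squares of natural numbers, and a sum of naturals vanishes only if each summand
-- does.
normSq≡0⇒≡0ᵍ : ∀ x → normSq x ≡ + 0 → x ≡ 0ᵍ
normSq≡0⇒≡0ᵍ (a + b i) eq = cong₂ _+_i
  (∣i∣*∣i∣≡0⇒i≡0 a (ℕ.m+n≡0⇒m≡0 _ sum≡0))
  (∣i∣*∣i∣≡0⇒i≡0 b (ℕ.m+n≡0⇒n≡0 (∣ a ∣ ℕ.* ∣ a ∣) sum≡0))
  where
  sum≡0 : ∣ a ∣ ℕ.* ∣ a ∣ ℕ.+ ∣ b ∣ ℕ.* ∣ b ∣ ≡ 0
  sum≡0 = ℤ.+-injective (trans (sym (cong₂ _+_ (i*i≡+∣i∣*∣i∣ a) (i*i≡+∣i∣*∣i∣ b))) eq)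

-- The norm is multiplicative and vanishes only at 0, so the property is inherited from the
-- integers.
*ᵍ-≢0 : ∀ {x y} → x ≢ 0ᵍ → y ≢ 0ᵍ → x *ᵍ y ≢ 0ᵍ
*ᵍ-≢0 {x} {y} x≢0 y≢0 xy≡0
  with ℤ.i*j≡0⇒i≡0∨j≡0 (normSq x) (trans (sym (normSq-*ᵍ x y)) (cong normSq xy≡0))
... | inj₁ Nx≡0 = x≢0 (normSq≡0⇒≡0ᵍ x Nx≡0)
... | inj₂ Ny≡0 = y≢0 (normSq≡0⇒≡0ᵍ y Ny≡0)

x*y≢0⇒x≢0 : ∀ {x y z} → x *ᵍ y ≡ z → z ≢ 0ᵍ → x ≢ 0ᵍ
-- `0ᵍ *ᵍ y` computes to `0ᵍ` even for a variable `y`.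
x*y≢0⇒x≢0 xy≡z z≢0 refl = z≢0 (sym xy≡z)

x*y≢0⇒y≢0 : ∀ x {y z} → x *ᵍ y ≡ z → z ≢ 0ᵍ → y ≢ 0ᵍ
x*y≢0⇒y≢0 x {y} xy≡z = x*y≢0⇒x≢0 (trans (*ᵍ-comm y x) xy≡z)

-ᵍ-≢0 : ∀ {x} → x ≢ 0ᵍ → -ᵍ x ≢ 0ᵍ
-ᵍ-≢0 {x} x≢0 -x≡0 = x≢0 (trans (-ᵍ-involutive x) (cong -ᵍ_ -x≡0))
  where
  -ᵍ-involutive : ∀ x → x ≡ -ᵍ -ᵍ x
  -ᵍ-involutive = solve-∀-over gaussianRing

-- Decompositions for each shape of `n`.

iᵍ 1+i 2ᵍ : ℤ[i]
iᵍ = (+ 0) + (+ 1) i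
1+i = (+ 1) + (+ 1) i
2ᵍ = (+ 2) + (+ 0) i

1ᵍ≢0 : 1ᵍ ≢ 0ᵍ
1ᵍ≢0 ()

2ᵍ≢0 : 2ᵍ ≢ 0ᵍ
2ᵍ≢0 ()

1+i≢0 : 1+i ≢ 0ᵍ
1+i≢0 ()

Solvable : ℤ[i] → Set
Solvable n =
  Σ ℤ[i] λ a → Σ ℤ[i] λ b → Σ ℤ[i] λ c →
    ¬ a ≡ 0ᵍ × ¬ b ≡ 0ᵍ × ¬ c ≡ 0ᵍ × ErdosStrausEq n a b c

-- The last hypothesis says s/(nk) = 1/d + 1/e.
solvable-split : ∀ {n} k s d e → k ≢ 0ᵍ → d ≢ 0ᵍ → e ≢ 0ᵍ → n ≡ 4ᵍ *ᵍ k +ᵍ s →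
                 s *ᵍ (d *ᵍ e) ≡ n *ᵍ k *ᵍ (d +ᵍ e) → Solvable n
solvable-split {n} k s d e k≢0 d≢0 e≢0 n≡4k+s split =
  k , -ᵍ d , -ᵍ e , k≢0 , -ᵍ-≢0 d≢0 , -ᵍ-≢0 e≢0 , (begin
    4ᵍ *ᵍ k *ᵍ -ᵍ d *ᵍ -ᵍ e
      ≡⟨ lhs k s d e ⟩
    (4ᵍ *ᵍ k +ᵍ s) *ᵍ (d *ᵍ e) -ᵍ s *ᵍ (d *ᵍ e)
      ≡⟨ cong₂ (λ m w → m *ᵍ (d *ᵍ e) -ᵍ w) (sym n≡4k+s) split ⟩
    n *ᵍ (d *ᵍ e) -ᵍ n *ᵍ k *ᵍ (d +ᵍ e)
      ≡⟨ rhs n k d e ⟩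
    n *ᵍ (-ᵍ d *ᵍ -ᵍ e +ᵍ k *ᵍ -ᵍ e +ᵍ k *ᵍ -ᵍ d) ∎)
  where
  lhs : ∀ k s d e → 4ᵍ *ᵍ k *ᵍ (-ᵍ d) *ᵍ (-ᵍ e) ≡ (4ᵍ *ᵍ k +ᵍ s) *ᵍ (d *ᵍ e) +ᵍ -ᵍ (s *ᵍ (d *ᵍ e))
  lhs = solve-∀-over gaussianRing
  rhs : ∀ n k d e → n *ᵍ (d *ᵍ e) +ᵍ -ᵍ (n *ᵍ k *ᵍ (d +ᵍ e))
                  ≡ n *ᵍ ((-ᵍ d) *ᵍ (-ᵍ e) +ᵍ k *ᵍ (-ᵍ e) +ᵍ k *ᵍ (-ᵍ d))
  rhs = solve-∀-over gaussianRing

solvable-even : ∀ {n} m → n ≢ 0ᵍ → n ≡ 2ᵍ *ᵍ m → Solvable n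
solvable-even {n} m n≢0 refl = m , n , n , x*y≢0⇒y≢0 2ᵍ refl n≢0 , n≢0 , n≢0 , eq m
  where
  eq : ∀ m → 4ᵍ *ᵍ m *ᵍ (2ᵍ *ᵍ m) *ᵍ (2ᵍ *ᵍ m)
           ≡ 2ᵍ *ᵍ m *ᵍ (2ᵍ *ᵍ m *ᵍ (2ᵍ *ᵍ m) +ᵍ m *ᵍ (2ᵍ *ᵍ m) +ᵍ m *ᵍ (2ᵍ *ᵍ m))
  eq = solve-∀-over gaussianRing

-- Since u = 2/v, the remainder u/(nk) equals 2/(nkv), that is 1/e + 1/e with e = nkv.
solvable-4k+u : ∀ {n} k u v → n ≢ 0ᵍ → k ≢ 0ᵍ → u *ᵍ v ≡ 2ᵍ → n ≡ 4ᵍ *ᵍ k +ᵍ u → Solvable n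
solvable-4k+u {n} k u v n≢0 k≢0 uv≡2 n≡4k+u =
  solvable-split k u e e k≢0 e≢0 e≢0 n≡4k+u
    -- The ring solver uses no hypotheses: `lhs` isolates the product `u *ᵍ v`, which is replaced by
    -- `2ᵍ` before `rhs` applies.
    (trans (lhs n k u v) (trans (cong (_*ᵍ (n *ᵍ k *ᵍ e)) uv≡2) (rhs n k v)))
  where
  e = n *ᵍ k *ᵍ v
  e≢0 : e ≢ 0ᵍ
  e≢0 = *ᵍ-≢0 (*ᵍ-≢0 n≢0 k≢0) (x*y≢0⇒y≢0 u uv≡2 2ᵍ≢0)
  lhs : ∀ n k u v → u *ᵍ (n *ᵍ k *ᵍ v *ᵍ (n *ᵍ k *ᵍ v)) ≡ u *ᵍ v *ᵍ (n *ᵍ k *ᵍ (n *ᵍ k *ᵍ v))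
  lhs = solve-∀-over gaussianRing
  rhs : ∀ n k v → 2ᵍ *ᵍ (n *ᵍ k *ᵍ (n *ᵍ k *ᵍ v)) ≡ n *ᵍ k *ᵍ (n *ᵍ k *ᵍ v +ᵍ n *ᵍ k *ᵍ v)
  rhs = solve-∀-over gaussianRing

-- With p = q + u the fractions are 1/q + 1/p - u²/(pq(p + q)), and (p + q)² - u² = 4pq.
solvable-2q+u : ∀ q u t → q ≢ 0ᵍ → q +ᵍ u ≢ 0ᵍ → q +ᵍ u +ᵍ q ≢ 0ᵍ → u *ᵍ t ≡ 1ᵍ →
                Solvable (q +ᵍ u +ᵍ q)
solvable-2q+u q u t q≢0 p≢0 n≢0 ut≡1 =
  q , p , -ᵍ c , q≢0 , p≢0 , -ᵍ-≢0 c≢0 , (begin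
    4ᵍ *ᵍ q *ᵍ p *ᵍ -ᵍ c
      ≡⟨ lhs q u t ⟩
    n *ᵍ (u *ᵍ t *ᵍ (u *ᵍ t) *ᵍ (q *ᵍ p) -ᵍ n *ᵍ c)
      ≡⟨ cong (λ w → n *ᵍ (w *ᵍ w *ᵍ (q *ᵍ p) -ᵍ n *ᵍ c)) ut≡1 ⟩
    n *ᵍ (1ᵍ *ᵍ 1ᵍ *ᵍ (q *ᵍ p) -ᵍ n *ᵍ c)
      ≡⟨ rhs q u c ⟩
    n *ᵍ (p *ᵍ -ᵍ c +ᵍ q *ᵍ -ᵍ c +ᵍ q *ᵍ p) ∎)
  where
  p = q +ᵍ u
  n = p +ᵍ q
  -- As `t` inverts `u`, this is pqn/u².
  c = q *ᵍ p *ᵍ n *ᵍ (t *ᵍ t)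
  t≢0 : t ≢ 0ᵍ
  t≢0 = x*y≢0⇒y≢0 u ut≡1 1ᵍ≢0
  c≢0 : c ≢ 0ᵍ
  c≢0 = *ᵍ-≢0 (*ᵍ-≢0 (*ᵍ-≢0 q≢0 p≢0) n≢0) (*ᵍ-≢0 t≢0 t≢0)
  lhs : ∀ q u t → 4ᵍ *ᵍ q *ᵍ (q +ᵍ u) *ᵍ (-ᵍ (q *ᵍ (q +ᵍ u) *ᵍ (q +ᵍ u +ᵍ q) *ᵍ (t *ᵍ t)))
    ≡ (q +ᵍ u +ᵍ q) *ᵍ (u *ᵍ t *ᵍ (u *ᵍ t) *ᵍ (q *ᵍ (q +ᵍ u))
        +ᵍ -ᵍ ((q +ᵍ u +ᵍ q) *ᵍ (q *ᵍ (q +ᵍ u) *ᵍ (q +ᵍ u +ᵍ q) *ᵍ (t *ᵍ t))))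
  lhs = solve-∀-over gaussianRing
  rhs : ∀ q u c → (q +ᵍ u +ᵍ q) *ᵍ (1ᵍ *ᵍ 1ᵍ *ᵍ (q *ᵍ (q +ᵍ u)) +ᵍ -ᵍ ((q +ᵍ u +ᵍ q) *ᵍ c))
    ≡ (q +ᵍ u +ᵍ q) *ᵍ ((q +ᵍ u) *ᵍ (-ᵍ c) +ᵍ q *ᵍ (-ᵍ c) +ᵍ q *ᵍ (q +ᵍ u))
  rhs = solve-∀-over gaussianRing

-- With p = q + u and k = pj, the remainder (p + q)/(nk) is p/(npj) + q/(nk) = 1/(nj) + 1/(nkr),
-- because `r` inverts `q`. The sum `q +ᵍ u +ᵍ q` parses as p + q.
solvable-4k+2q+u : ∀ {n} j q r u t → n ≢ 0ᵍ → q *ᵍ r ≡ 1ᵍ → u *ᵍ t ≡ 1ᵍ → q +ᵍ u ≢ 0ᵍ →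
                   n ≡ 4ᵍ *ᵍ ((q +ᵍ u) *ᵍ j) +ᵍ (q +ᵍ u +ᵍ q) → Solvable n
solvable-4k+2q+u {n} j q r u t n≢0 qr≡1 ut≡1 p≢0 n≡ with j ≟ᵍ 0ᵍ
-- Here k = 0, so no term 1/k can be split off, and n = 2q + u.
... | yes refl = subst Solvable (sym n≡s) (solvable-2q+u q u t (x*y≢0⇒x≢0 qr≡1 1ᵍ≢0) p≢0 (n≢0 ∘ trans n≡s) ut≡1)
  where
  drop-0 : ∀ p s → 4ᵍ *ᵍ (p *ᵍ 0ᵍ) +ᵍ s ≡ s
  drop-0 = solve-∀-over gaussianRing
  n≡s : n ≡ q +ᵍ u +ᵍ q
  n≡s = trans n≡ (drop-0 (q +ᵍ u) (q +ᵍ u +ᵍ q))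
... | no j≢0 =
  solvable-split (p *ᵍ j) (p +ᵍ q) (n *ᵍ j) (n *ᵍ (p *ᵍ j) *ᵍ r)
    k≢0 (*ᵍ-≢0 n≢0 j≢0) (*ᵍ-≢0 (*ᵍ-≢0 n≢0 k≢0) (x*y≢0⇒y≢0 q qr≡1 1ᵍ≢0)) n≡
    (trans (lhs n j p q r)
      (trans (cong (λ w → n *ᵍ n *ᵍ j *ᵍ j *ᵍ p *ᵍ (p *ᵍ r +ᵍ w)) qr≡1) (rhs n j p r)))
  where
  p = q +ᵍ u
  k≢0 : p *ᵍ j ≢ 0ᵍ
  k≢0 = *ᵍ-≢0 p≢0 j≢0
  lhs : ∀ n j p q r → (p +ᵍ q) *ᵍ (n *ᵍ j *ᵍ (n *ᵍ (p *ᵍ j) *ᵍ r))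
                    ≡ n *ᵍ n *ᵍ j *ᵍ j *ᵍ p *ᵍ (p *ᵍ r +ᵍ q *ᵍ r)
  lhs = solve-∀-over gaussianRing
  rhs : ∀ n j p r → n *ᵍ n *ᵍ j *ᵍ j *ᵍ p *ᵍ (p *ᵍ r +ᵍ 1ᵍ)
                  ≡ n *ᵍ (p *ᵍ j) *ᵍ (n *ᵍ j +ᵍ n *ᵍ (p *ᵍ j) *ᵍ r)
  rhs = solve-∀-over gaussianRing

-- Residues modulo 1 + i.

m+n≡o⇒o-m≡n : ∀ m n {o} → m + n ≡ o → o - m ≡ n
m+n≡o⇒o-m≡n m n refl = eq m n
  where
  eq : ∀ m n → m + n - m ≡ n
  eq = solve-∀

data Mod[1+i] : ℤ[i] → Set where
  even : ∀ j → Mod[1+i] (1+i *ᵍ j)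
  odd  : ∀ j → Mod[1+i] (1+i *ᵍ j +ᵍ 1ᵍ)

-- Modulo 1 + i one has i ≡ 1, so a + bi ≡ a + b; as 1 + i divides 2, the parity of a + b decides.
mod[1+i] : ∀ x → Mod[1+i] x
mod[1+i] (a + b i) with (a + b) %ℕ 2 | n%ℕd<d (a + b) 2 | (a + b) /ℕ 2 | a≡a%ℕn+[a/ℕn]*n (a + b) 2
... | 0 | _ | h | a+b≡ =
  -- (a + bi)/(1 + i) = ((a + b) + (b - a)i)/2, and a + b = 2h makes this h + (h - a)i. The odd case
  -- divides a - 1 + bi in the same way.
  subst Mod[1+i] (cong₂ _+_i (re≡ a h) (trans (im≡ a h) (m+n≡o⇒o-m≡n a b a+b≡))) (even (h + (h - a) i))
  where
  re≡ : ∀ a h → + 1 * h - + 1 * (h - a) ≡ a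
  re≡ = solve-∀
  im≡ : ∀ a h → + 1 * (h - a) + + 1 * h ≡ + 0 + h * + 2 - a
  im≡ = solve-∀
... | 1 | _ | h | a+b≡ =
  subst Mod[1+i] (cong₂ _+_i (re≡ a h) (trans (im≡ a h) (m+n≡o⇒o-m≡n a b a+b≡))) (odd (h + (h - a + + 1) i))
  where
  re≡ : ∀ a h → + 1 * h - + 1 * (h - a + + 1) + + 1 ≡ a
  re≡ = solve-∀
  im≡ : ∀ a h → + 1 * (h - a + + 1) + + 1 * h + + 0 ≡ + 1 + h * + 2 - a
  im≡ = solve-∀
... | suc (suc _) | s≤s (s≤s ()) | _ | _

-- If k is not divisible by 1 + i then k + q is, and n = 4(k + q) - 2q + u.
solvable-4k+2q+u-units : ∀ {n} k q r u t g h e → n ≢ 0ᵍ → q *ᵍ r ≡ 1ᵍ → u *ᵍ t ≡ 1ᵍ →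
               (q +ᵍ u) *ᵍ g ≡ 1+i → (-ᵍ q +ᵍ u) *ᵍ h ≡ 1+i → 1+i *ᵍ e ≡ 1ᵍ +ᵍ q →
               n ≡ 4ᵍ *ᵍ k +ᵍ (q +ᵍ u +ᵍ q) → Solvable n
solvable-4k+2q+u-units k q r u t g h e n≢0 qr≡1 ut≡1 pg≡ p′h≡ e≡ n≡ with mod[1+i] k
-- k = (1 + i)j = p(gj), where p = q + u.
... | even j = solvable-4k+2q+u (g *ᵍ j) q r u t n≢0 qr≡1 ut≡1 (x*y≢0⇒x≢0 pg≡ 1+i≢0)
  (trans n≡ (cong (λ w → 4ᵍ *ᵍ w +ᵍ (q +ᵍ u +ᵍ q))
    (trans (cong (_*ᵍ j) (sym pg≡)) (*ᵍ-assoc (q +ᵍ u) g j))))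
-- Now k + q = (1 + i)j + (1 + q) = (1 + i)(j + e), and `h` is the cofactor turning 1 + i into a
-- multiple of -q + u.
... | odd j = solvable-4k+2q+u (h *ᵍ (j +ᵍ e)) (-ᵍ q) (-ᵍ r) u t n≢0 (trans (neg-neg q r) qr≡1) ut≡1
  (x*y≢0⇒x≢0 p′h≡ 1+i≢0)
  (trans n≡ (trans (shift j q u) (cong (λ w → 4ᵍ *ᵍ w +ᵍ (-ᵍ q +ᵍ u +ᵍ -ᵍ q)) k+q≡)))
  where
  neg-neg : ∀ q r → (-ᵍ q) *ᵍ (-ᵍ r) ≡ q *ᵍ r
  neg-neg = solve-∀-over gaussianRing
  shift : ∀ j q u → 4ᵍ *ᵍ (1+i *ᵍ j +ᵍ 1ᵍ) +ᵍ (q +ᵍ u +ᵍ q)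
                  ≡ 4ᵍ *ᵍ (1+i *ᵍ j +ᵍ (1ᵍ +ᵍ q)) +ᵍ ((-ᵍ q) +ᵍ u +ᵍ (-ᵍ q))
  shift = solve-∀-over gaussianRing
  k+q≡ : 1+i *ᵍ j +ᵍ (1ᵍ +ᵍ q) ≡ (-ᵍ q +ᵍ u) *ᵍ (h *ᵍ (j +ᵍ e))
  k+q≡ = begin
    1+i *ᵍ j +ᵍ (1ᵍ +ᵍ q)             ≡⟨ cong (1+i *ᵍ j +ᵍ_) (sym e≡) ⟩
    1+i *ᵍ j +ᵍ 1+i *ᵍ e              ≡⟨ sym (*ᵍ-distribˡ-+ᵍ 1+i j e) ⟩
    1+i *ᵍ (j +ᵍ e)                   ≡⟨ cong (_*ᵍ (j +ᵍ e)) (sym p′h≡) ⟩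
    (-ᵍ q +ᵍ u) *ᵍ h *ᵍ (j +ᵍ e)      ≡⟨ *ᵍ-assoc (-ᵍ q +ᵍ u) h (j +ᵍ e) ⟩
    (-ᵍ q +ᵍ u) *ᵍ (h *ᵍ (j +ᵍ e))    ∎


-- Residues modulo 4 and the case analysis.

-- Using -1 in place of 3 keeps every residue with both coordinates in {0, 1, -1} at norm at most 2.
balanced : Fin 4 → ℤ
balanced 0F = + 0
balanced 1F = + 1
balanced 2F = + 2
balanced 3F = - + 1

balanced-mod4 : ∀ x → ∃₂ λ q r → x ≡ + 4 * q + balanced r
balanced-mod4 x with x %ℕ 4 | n%ℕd<d x 4 | x /ℕ 4 | a≡a%ℕn+[a/ℕn]*n x 4
... | 0 | _ | q | x≡ = q , 0F , trans x≡ (eq q)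
  where
  eq : ∀ q → + 0 + q * + 4 ≡ + 4 * q + + 0
  eq = solve-∀
... | 1 | _ | q | x≡ = q , 1F , trans x≡ (eq q)
  where
  eq : ∀ q → + 1 + q * + 4 ≡ + 4 * q + + 1
  eq = solve-∀
... | 2 | _ | q | x≡ = q , 2F , trans x≡ (eq q)
  where
  eq : ∀ q → + 2 + q * + 4 ≡ + 4 * q + + 2
  eq = solve-∀
-- 3 + 4q = 4(q + 1) - 1, hence the raised quotient.
... | 3 | _ | q | x≡ = q + + 1 , 3F , trans x≡ (eq q)
  where
  eq : ∀ q → + 3 + q * + 4 ≡ + 4 * (q + + 1) + - + 1
  eq = solve-∀
... | suc (suc (suc (suc _))) | s≤s (s≤s (s≤s (s≤s ()))) | _ | _

solvable-residue : ∀ {n} k r t → ¬ inE₋₁ n →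
                   n ≡ 4ᵍ *ᵍ k +ᵍ (balanced r + balanced t i) → Solvable n
solvable-residue {n} k r t n∉E n≡ = go r t n≡
  where
  n≢0 : n ≢ 0ᵍ
  n≢0 n≡0 = n∉E (subst inE₋₁ (sym n≡0) (toWitness {a? = + 0 ℤ.≤? + 2} _))

  even-residue : ∀ s → n ≡ 4ᵍ *ᵍ k +ᵍ 2ᵍ *ᵍ s → Solvable n
  even-residue s n≡ = solvable-even (2ᵍ *ᵍ k +ᵍ s) n≢0 (trans n≡ (eq k s))
    where
    eq : ∀ k s → 4ᵍ *ᵍ k +ᵍ 2ᵍ *ᵍ s ≡ 2ᵍ *ᵍ (2ᵍ *ᵍ k +ᵍ s)
    eq = solve-∀-over gaussianRing

  near : ∀ u v {_ : True (normSq u ℤ.≤? + 2)} → u *ᵍ v ≡ 2ᵍ → n ≡ 4ᵍ *ᵍ k +ᵍ u → Solvable n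
  near u v {u∈E} uv≡2 n≡ = solvable-4k+u k u v n≢0 k≢0 uv≡2 n≡
    where
    drop-0 : ∀ u → 4ᵍ *ᵍ 0ᵍ +ᵍ u ≡ u
    drop-0 = solve-∀-over gaussianRing
    k≢0 : k ≢ 0ᵍ
    -- If k = 0 then n = u has norm at most 2; this is where the excluded set enters.
    k≢0 k≡0 = n∉E (subst inE₋₁
      (sym (trans n≡ (trans (cong (λ w → 4ᵍ *ᵍ w +ᵍ u) k≡0) (drop-0 u)))) (toWitness u∈E))

  far : ∀ q r u t g h e → q *ᵍ r ≡ 1ᵍ → u *ᵍ t ≡ 1ᵍ →
        (q +ᵍ u) *ᵍ g ≡ 1+i → (-ᵍ q +ᵍ u) *ᵍ h ≡ 1+i → 1+i *ᵍ e ≡ 1ᵍ +ᵍ q →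
        n ≡ 4ᵍ *ᵍ k +ᵍ (q +ᵍ u +ᵍ q) → Solvable n
  far q r u t g h e = solvable-4k+2q+u-units k q r u t g h e n≢0

  go : ∀ r t → n ≡ 4ᵍ *ᵍ k +ᵍ (balanced r + balanced t i) → Solvable n
  go 0F 0F = even-residue 0ᵍ
  go 0F 2F = even-residue iᵍ
  go 2F 0F = even-residue 1ᵍ
  go 2F 2F = even-residue 1+i
  -- In each `near` case the second argument is 2/u.
  go 1F 0F = near 1ᵍ 2ᵍ refl
  go 3F 0F = near (-ᵍ 1ᵍ) (-ᵍ 2ᵍ) refl
  go 0F 1F = near iᵍ (-ᵍ iᵍ *ᵍ 2ᵍ) refl
  go 0F 3F = near (-ᵍ iᵍ) (iᵍ *ᵍ 2ᵍ) refl
  go 1F 1F = near 1+i (1ᵍ -ᵍ iᵍ) refl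
  go 1F 3F = near (1ᵍ -ᵍ iᵍ) 1+i refl
  go 3F 1F = near (iᵍ -ᵍ 1ᵍ) (-ᵍ 1+i) refl
  go 3F 3F = near (-ᵍ 1+i) (iᵍ -ᵍ 1ᵍ) refl
  -- The residue is 2q + u. The arguments are q, 1/q, u, 1/u, (1 + i)/(q + u), (1 + i)/(u - q) and
  -- (1 + q)/(1 + i).
  go 2F 1F = far 1ᵍ 1ᵍ iᵍ (-ᵍ iᵍ) 1ᵍ (-ᵍ iᵍ) (1ᵍ -ᵍ iᵍ) refl refl refl refl refl
  go 2F 3F = far 1ᵍ 1ᵍ (-ᵍ iᵍ) iᵍ iᵍ (-ᵍ 1ᵍ) (1ᵍ -ᵍ iᵍ) refl refl refl refl refl
  go 1F 2F = far iᵍ (-ᵍ iᵍ) 1ᵍ 1ᵍ 1ᵍ iᵍ 1ᵍ refl refl refl refl refl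
  go 3F 2F = far iᵍ (-ᵍ iᵍ) (-ᵍ 1ᵍ) (-ᵍ 1ᵍ) (-ᵍ iᵍ) (-ᵍ 1ᵍ) 1ᵍ refl refl refl refl refl

theorem10 : (n : ℤ[i]) → ¬ inE₋₁ n →
    Σ ℤ[i] (λ a → Σ ℤ[i] (λ b → Σ ℤ[i] (λ c →
    ¬ a ≡ 0ᵍ × ¬ b ≡ 0ᵍ × ¬ c ≡ 0ᵍ × ErdosStrausEq n a b c)))
theorem10 (x + y i) n∉E with balanced-mod4 x | balanced-mod4 y
... | q , r , x≡ | q′ , t , y≡ = solvable-residue (q + q′ i) r t n∉E
  (cong₂ _+_i (trans x≡ (re≡ q q′ (balanced r))) (trans y≡ (im≡ q q′ (balanced t))))
  where
  re≡ : ∀ a b r → + 4 * a + r ≡ + 4 * a - + 0 * b + r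
  re≡ = solve-∀
  im≡ : ∀ a b r → + 4 * b + r ≡ + 4 * b + + 0 * a + r
  im≡ = solve-∀
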